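{- Let $\mathcal I$ be an ideal on $\omega$ that is weakly selective and $q^+$. Then for every $Y\in\mathcal I^+$ we have $\mathcal{ED}_{\mathrm{fin}}\not\le_K\mathcal I\upharpoonright Y$. Consequently, for every ideal $\mathcal J\subseteq\mathcal I$ and every $Y\in\mathcal I^+$, $\mathcal{ED}_{\mathrm{fin}}\not\le_K\mathcal J\upharpoonright Y$.
   Context: Ideals on a countable set are proper and contain all finite sets. $\mathcal I^+=\mathcal P(\omega)\setminus\mathcal I$; $\mathcal I\upharpoonright Y=\{A\subseteq\omega:A\cap Y\in\mathcal I\}$. For ideals $\mathcal I$ on $E$ and $\mathcal J$ on $D$, $\mathcal I\le_K\mathcal J$ (Katětov reducibility) means there is $f:D\to E$ (a witness) with $f^{ -1}[A]\in\mathcal J$ for all $A\in\mathcal I$. $\mathcal I$ is weakly selective if every partition of an $\mathcal I$-positive set into pieces belonging to $\mathcal I$ has an $\mathcal I$-positive selector (a subset of the partitioned set meeting each piece in at most one point). $\mathcal I$ is $q^+$ if every partition of an $\mathcal I$-positive set into finite pieces has an $\mathcal I$-positive selector. Let $\Delta=\{(n,m)\in\omega\times\omega:m\le n\}$; $\mathcal{ED}_{\mathrm{fin}}$ is the ideal on $\Delta$ of all $A\subseteq\Delta$ for which there are $k,n_0$ with $|\{m:(n,m)\in A\}|\le k$ for all $n\ge n_0$. -}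

module Defs where

open import Data.Fin using (zero; suc)
open import Data.Fin.Properties using (injective⇒≤)
open import Data.List using (List; _∷_; length; lookup)
open import Data.List.Membership.Propositional using () renaming (_∈_ to _∈ˡ_)
open import Data.List.Membership.Propositional.Properties using (∈-lookup)
open import Data.List.Membership.Setoid.Properties using (index-injective)
open import Data.List.Relation.Unary.All as All using (All)
open import Data.List.Relation.Unary.AllPairs using (_∷_)
open import Data.List.Relation.Unary.Any using (index)
open import Data.List.Relation.Unary.Unique.Propositional using (Unique)
open import Data.Nat using (ℕ; _≤_)
open import Data.Nat.Properties using (≤-trans)
open import Data.Product using (Σ-syntax; ∃₂; ∃-syntax; _×_; _,_)
open import Function.Bundles using (_⇔_; mk⇔)
open import Level using (Level; 0ℓ) renaming (suc to lsuc)
open import Relation.Binary.PropositionalEquality using (_≡_; refl; sym; cong; setoid)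
open import Relation.Nullary using (contradiction)
open import Relation.Unary
  using (Pred; _∈_; _∉_; _⊆_; _≐_; _∪_; _∩_; _≬_; _⊢_; ∁; U; Satisfiable)

private
  variable
    ℓ ℓ′ : Level
    D E : Set

Subset : Set → Set₁
Subset E = Pred E 0ℓ

Family : Set → (ℓ : Level) → Set (lsuc 0ℓ Level.⊔ lsuc ℓ)
Family E ℓ = Pred (Subset E) ℓ

-- Contained in a list: for undecidable A this is weaker than being enumerated
-- by a list, and classically the two agree.
Finite : Subset E → Set
Finite A = ∃[ xs ] (∀ {x} → x ∈ A → x ∈ˡ xs)

record IsIdeal {E : Set} (I : Family E ℓ) : Set (lsuc 0ℓ Level.⊔ ℓ) where
  field
    proper     : U ∉ I
    finite     : ∀ {A} → Finite A → A ∈ I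
    downwards  : ∀ {A B} → A ⊆ B → B ∈ I → A ∈ I
    union      : ∀ {A B} → A ∈ I → B ∈ I → (A ∪ B) ∈ I

infix 10 _⁺
_⁺ : Family E ℓ → Family E ℓ
I ⁺ = ∁ I

infixl 9 _↾_
_↾_ : Family E ℓ → Subset E → Family E ℓ
(I ↾ Y) A = (A ∩ Y) ∈ I

infix 4 _≤K_
_≤K_ : Family E ℓ → Family D ℓ′ → Set (lsuc 0ℓ Level.⊔ ℓ Level.⊔ ℓ′)
_≤K_ {E = E} {D = D} I J =
  Σ[ f ∈ (D → E) ] (∀ A → A ∈ I → (f ⊢ A) ∈ J)

record IsPartition {E : Set} (X : Subset E) (𝒫 : Family E 0ℓ) : Set₁ where
  field
    inhabited : ∀ {P} → P ∈ 𝒫 → Satisfiable P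
    inside    : ∀ {P} → P ∈ 𝒫 → P ⊆ X
    covers    : ∀ {x} → x ∈ X → ∃[ P ] (P ∈ 𝒫 × x ∈ P)
    disjoint  : ∀ {P Q} → P ∈ 𝒫 → Q ∈ 𝒫 → P ≬ Q → P ≐ Q

record IsSelector {E : Set} (X : Subset E) (𝒫 : Family E 0ℓ) (S : Subset E) : Set₁ where
  field
    inside : S ⊆ X
    single : ∀ {P} → P ∈ 𝒫 → ∀ {x y} → x ∈ S ∩ P → y ∈ S ∩ P → x ≡ y

WeaklySelective : Family E ℓ → Set (lsuc 0ℓ Level.⊔ ℓ)
WeaklySelective I =
  ∀ X → X ∈ I ⁺ → ∀ 𝒫 → IsPartition X 𝒫 → (∀ {P} → P ∈ 𝒫 → P ∈ I) →
  ∃[ S ] (IsSelector X 𝒫 S × S ∈ I ⁺)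

Q⁺ : Family E ℓ → Set (lsuc 0ℓ Level.⊔ ℓ)
Q⁺ I =
  ∀ X → X ∈ I ⁺ → ∀ 𝒫 → IsPartition X 𝒫 → (∀ {P} → P ∈ 𝒫 → Finite P) →
  ∃[ S ] (IsSelector X 𝒫 S × S ∈ I ⁺)

-- |A| ≤ k, without assuming that membership in A is decidable; when A can be
-- enumerated, this is the usual comparison of cardinalities
-- (hasAtMost-enumerated).
infix 4 _hasAtMost_
_hasAtMost_ : Subset E → ℕ → Set
A hasAtMost k = ∀ xs → Unique xs → All A xs → length xs ≤ k

hasAtMost-enumerated : ∀ {A : Subset E} {xs} → Unique xs → A ≐ (_∈ˡ xs) →
                       ∀ {k} → A hasAtMost k ⇔ length xs ≤ k
hasAtMost-enumerated {A = A} {xs} xs! (A⊆xs , xs⊆A) = mk⇔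
  (λ A≤k → A≤k xs xs! (All.tabulate xs⊆A))
  (λ xs≤k ys ys! ysA → ≤-trans (shorter ys ys! ysA) xs≤k)
  where
  lookup-injective : ∀ {ys : List _} → Unique ys → ∀ i j → lookup ys i ≡ lookup ys j → i ≡ j
  lookup-injective {_ ∷ _} _          zero    zero    _  = refl
  lookup-injective {_ ∷ _} (y≢ ∷ _)   zero    (suc j) eq = contradiction eq (All.lookup y≢ (∈-lookup j))
  lookup-injective {_ ∷ _} (y≢ ∷ _)   (suc i) zero    eq = contradiction (sym eq) (All.lookup y≢ (∈-lookup i))
  lookup-injective {_ ∷ _} (_  ∷ ys!) (suc i) (suc j) eq = cong suc (lookup-injective ys! i j eq)

  shorter : ∀ ys → Unique ys → All A ys → length ys ≤ length xs
  shorter ys ys! ysA = injective⇒≤ {f = λ i → index (member i)}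
    (λ {i} {j} eq →
      lookup-injective ys! i j (index-injective (setoid _) (member i) (member j) eq))
    where
    member : ∀ i → lookup ys i ∈ˡ xs
    member i = A⊆xs (All.lookup ysA (∈-lookup i))

Δ : Set
Δ = Σ[ (n , m) ∈ ℕ × ℕ ] m ≤ n

column : Subset Δ → ℕ → Subset ℕ
column A n m = Σ[ m≤n ∈ m ≤ n ] ((n , m) , m≤n) ∈ A

EDfin : Family Δ 0ℓ
EDfin A = ∃₂ λ k n₀ → ∀ n → n₀ ≤ n → column A n hasAtMost k

{-# OPTIONS --safe #-}

-- Let f witness EDfin ≤K I ↾ Y and partition Y by the first coordinate of f.
-- Each column of Δ lies in EDfin, so the pieces lie in I, and weak selectivity
-- gives an I-positive selector S.  The image f[S] meets each column in at most
-- one point, so it lies in EDfin; hence S ⊆ f⁻¹[f[S]] ∩ Y is in I, a contradiction.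
module Submission where

open import Defs
open import Data.List using ([]; _∷_)
open import Data.List.Relation.Unary.All using ([]; _∷_)
open import Data.List.Relation.Unary.AllPairs using (_∷_)
open import Data.Nat using (ℕ; suc; z≤n; s≤s)
open import Data.Nat.Properties using (<-irrefl)
open import Data.Product using (∃-syntax; _×_; _,_; proj₁; proj₂)
open import Function using (_∘_)
open import Level using (Level)
open import Relation.Binary.PropositionalEquality using (_≡_; refl; sym; trans; cong)
open import Relation.Nullary using (¬_; contradiction)
open import Relation.Unary using (_∈_; _⊆_; _≐_; _∩_; Satisfiable)
open import Relation.Unary.Properties using (≐-refl; ≐-sym; ≐-trans)

private
  variable
    ℓ : Level
    D E : Set

fibre : Subset D → (D → E) → E → Subset D
fibre Y g e = Y ∩ (λ x → g x ≡ e)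

-- Empty fibres are dropped, since the pieces of a partition must be inhabited. Matching a fibre up
-- to `≐` instead of `≡` keeps the family at level 0, as `IsPartition` demands.
Fibres : Subset D → (D → E) → Family D _
Fibres Y g P = Satisfiable P × (∃[ e ] P ≐ fibre Y g e)

fibre∈Fibres : (Y : Subset D) (g : D → E) → ∀ {x} → x ∈ Y → fibre Y g (g x) ∈ Fibres Y g
fibre∈Fibres Y g {x} x∈Y = (x , x∈Y , refl) , g x , ≐-refl

Fibres-isPartition : (Y : Subset D) (g : D → E) → IsPartition Y (Fibres Y g)
Fibres-isPartition Y g = record
  { inhabited = proj₁
  ; inside    = λ (_ , _ , P⊆ , _) → proj₁ ∘ P⊆
  ; covers    = λ {x} x∈Y → fibre Y g (g x) , fibre∈Fibres Y g x∈Y , x∈Y , refl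
  ; disjoint  = disjoint
  }
  where
  disjoint : ∀ {P Q} → P ∈ Fibres Y g → Q ∈ Fibres Y g → (∃[ x ] (x ∈ P × x ∈ Q)) → P ≐ Q
  disjoint (_ , _ , P≐) (_ , _ , Q≐) (_ , x∈P , x∈Q)
    -- The common point forces both indices to be its value under `g`.
    with refl ← proj₂ (proj₁ P≐ x∈P) | refl ← proj₂ (proj₁ Q≐ x∈Q) = ≐-trans P≐ (≐-sym Q≐)

-- Both points lie in the fibre over `g x`, which is a piece and so holds at most one point of S.
selector-injective : {Y : Subset D} {g : D → E} {S : Subset D} → IsSelector Y (Fibres Y g) S →
                     ∀ {x y} → x ∈ S → y ∈ S → g x ≡ g y → x ≡ y
selector-injective {Y = Y} {g} S-sel x∈S y∈S gx≡gy =
  single (fibre∈Fibres Y g (inside x∈S)) (x∈S , inside x∈S , refl) (y∈S , inside y∈S , sym gx≡gy)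
  where open IsSelector S-sel

subsingleton⇒hasAtMost-1 : {A : Subset E} → (∀ {x y} → x ∈ A → y ∈ A → x ≡ y) → A hasAtMost 1
subsingleton⇒hasAtMost-1 A-sub []           _                 _               = z≤n
subsingleton⇒hasAtMost-1 A-sub (_ ∷ [])     _                 _               = s≤s z≤n
subsingleton⇒hasAtMost-1 A-sub (_ ∷ _ ∷ _) ((x≢y ∷ _) ∷ _) (x∈A ∷ y∈A ∷ _) =
  contradiction (A-sub x∈A y∈A) x≢y

abscissa : Δ → ℕ
abscissa = proj₁ ∘ proj₁

ordinate : Δ → ℕ
ordinate = proj₂ ∘ proj₁

abscissa-fibre∈EDfin : ∀ n → (λ d → abscissa d ≡ n) ∈ EDfin
-- Every column from `suc n` on is empty, hence the bound 0.
abscissa-fibre∈EDfin n = 0 , suc n , λ where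
  _ _   []      _ _                → z≤n
  _ n<n (_ ∷ _) _ ((_ , refl) ∷ _) → contradiction n<n (<-irrefl refl)

image : (D → E) → Subset D → Subset E
image f S e = ∃[ x ] (x ∈ S × f x ≡ e)

image∈EDfin : (f : D → Δ) {S : Subset D} →
              (∀ {x y} → x ∈ S → y ∈ S → abscissa (f x) ≡ abscissa (f y) → x ≡ y) →
              image f S ∈ EDfin
image∈EDfin f {S} inj = 1 , 0 , λ n _ → subsingleton⇒hasAtMost-1 column-subsingleton
  where
  column-subsingleton : ∀ {n m m′} → m ∈ column (image f S) n → m′ ∈ column (image f S) n → m ≡ m′
  column-subsingleton (_ , x , x∈S , fx≡) (_ , y , y∈S , fy≡)
    -- Both points of the column are now values of `f` at the same x. Comparing ordinates avoids
    -- comparing the proofs of `m ≤ n`.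
    with refl ← inj x∈S y∈S (trans (cong abscissa fx≡) (sym (cong abscissa fy≡)))
    = cong ordinate (trans (sym fx≡) fy≡)

weaklySelective⇒EDfin≰K : {I : Family D ℓ} → IsIdeal I → WeaklySelective I →
                          ∀ Y → Y ∈ I ⁺ → ¬ (EDfin ≤K I ↾ Y)
weaklySelective⇒EDfin≰K {I = I} I-ideal selective Y Y∈I⁺ (f , f-witness) =
  let S , S-sel , S∈I⁺ = selective Y Y∈I⁺ _ (Fibres-isPartition Y (abscissa ∘ f)) fibre∈I
  in S∈I⁺ (downwards (λ x∈S → (_ , x∈S , refl) , IsSelector.inside S-sel x∈S)
                     (f-witness (image f S) (image∈EDfin f (selector-injective S-sel))))
  where
  open IsIdeal I-ideal

  fibre∈I : ∀ {P} → P ∈ Fibres Y (abscissa ∘ f) → P ∈ I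
  fibre∈I (_ , n , P⊆ , _) =
    -- P is contained in the preimage under `f` of column n, cut down to Y.
    downwards (λ x∈P → let x∈Y , fx≡n = P⊆ x∈P in fx≡n , x∈Y) (f-witness _ (abscissa-fibre∈EDfin n))

theoremC : ∀ {ℓ ℓ′ : Level} (I : Family ℕ ℓ) → IsIdeal I → WeaklySelective I → Q⁺ I →
    (∀ (Y : Subset ℕ) → Y ∈ I ⁺ → ¬ (EDfin ≤K I ↾ Y)) ×
    (∀ (J : Family ℕ ℓ′) → IsIdeal J → J ⊆ I →
      ∀ (Y : Subset ℕ) → Y ∈ I ⁺ → ¬ (EDfin ≤K J ↾ Y))
theoremC I I-ideal selective _ = EDfin≰K , λ _ _ J⊆I Y Y∈I⁺ (f , f-witness) →
    -- The same `f` is a witness for I, because J ↾ Y is contained in I ↾ Y.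
    EDfin≰K Y Y∈I⁺ (f , λ A A∈EDfin → J⊆I (f-witness A A∈EDfin))
  where
  EDfin≰K : ∀ Y → Y ∈ I ⁺ → ¬ (EDfin ≤K I ↾ Y)
  EDfin≰K = weaklySelective⇒EDfin≰K I-ideal selective
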